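{- Let $I$ be a strongly stable ideal of $S=\mathbb{K}[x,y,z]$ such that $S/I$ has the strong Lefschetz property. Then $I$ is an almost revlex ideal and it is uniquely determined by the Hilbert function (that is, if $I'$ is a strongly stable ideal of $S$ such that $S/I'$ has the strong Lefschetz property and $S/I'$ has the same Hilbert function as $S/I$, then $I'=I$).
   Context: $\mathbb{K}$ is a field of characteristic $0$; $S=\mathbb{K}[x,y,z]$ has the standard grading; the variables are ordered $x=x_1$, $y=x_2$, $z=x_3$; "power-product" means monomial with coefficient $1$. A monomial ideal $I$ is strongly stable if for every power-product $t\in I$ and all $i<j$ with $x_j\mid t$, one has $x_i\cdot t/x_j\in I$. A monomial ideal $I$ is an almost revlex ideal if for every power-product $t$ in the minimal generating set of $I$, every power-product $t'$ of $S$ with $\deg(t')=\deg(t)$ and $t'>_{\mathrm{DegRevLex}}t$ belongs to $I$, where DegRevLex is the degree reverse lexicographic ordering with $x>y>z$. A graded ring $R=\bigoplus_{i\ge0}R_i$ over $\mathbb{K}$ with $\dim_{\mathbb{K}}R_i<\infty$ has the strong Lefschetz property (SLP) if there exists $\ell\in R_1$ such that for all $i\ge0$ and $s\ge1$ the map $\times\ell^s\colon R_i\to R_{i+s}$ has full rank (is injective or surjective). The Hilbert function of $R$ is $i\mapsto\dim_{\mathbb{K}}R_i$. Artinianity of $S/I$ is not assumed. -}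

module Defs where

open import Algebra.Apartness.Bundles using (HeytingField; HeytingCommutativeRing)
open import Algebra.Bundles using (CommutativeRing)
import Algebra.Definitions.RawMonoid as RawMonoidDefs
open import Data.Bool.Base using (if_then_else_)
open import Data.Fin.Base as Fin using (Fin; zero; suc)
open import Data.List.Base using (List; []; _∷_; [_]; _++_; map; foldr; cartesianProductWith)
open import Data.List.Relation.Unary.All using (All; []; _∷_)
open import Data.List.Relation.Unary.All.Properties using (++⁺)
open import Data.Nat.Base as ℕ using (ℕ; zero; suc)
import Data.Nat.Properties as ℕ
open import Data.Product.Base using (Σ; ∃; ∃-syntax; _×_; _,_; proj₁; proj₂)
open import Data.Sum.Base using (_⊎_)
open import Data.Vec.Base as Vec using (Vec; []; _∷_; lookup; replicate; zipWith; _[_]≔_)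
open import Data.Vec.Properties using (≡-dec)
import Data.Vec.Functional as Vector
open import Function.Definitions using (Injective; Surjective)
open import Level using (_⊔_) renaming (suc to lsuc)
open import Relation.Binary.Core using (Rel)
open import Relation.Binary.Definitions using (DecidableEquality)
open import Relation.Binary.PropositionalEquality using (_≡_; refl; cong; cong₂; trans; sym; module ≡-Reasoning)
open import Relation.Nullary.Decidable.Core using (does)
open import Relation.Nullary.Negation.Core using (¬_)
open import Relation.Unary using (Pred; _∈_; _⊆_; _≐_)

-- Power-products of x = x₁, y = x₂, z = x₃, as exponent vectors.
Monomial : Set
Monomial = Vec ℕ 3

infixl 7 _·_
_·_ : ∀ {n} → Vec ℕ n → Vec ℕ n → Vec ℕ n
_·_ = zipWith ℕ._+_

𝟙 : Monomial
𝟙 = replicate 3 0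

var : Fin 3 → Monomial
var i = 𝟙 [ i ]≔ 1

deg : ∀ {n} → Vec ℕ n → ℕ
deg = Vec.sum

_≟ᵐ_ : DecidableEquality Monomial
_≟ᵐ_ = ≡-dec ℕ._≟_

deg-· : ∀ {n} (u v : Vec ℕ n) → deg (u · v) ≡ deg u ℕ.+ deg v
deg-· []      []      = refl
deg-· (a ∷ u) (b ∷ v) = begin
  a ℕ.+ b ℕ.+ deg (u · v)         ≡⟨ cong (a ℕ.+ b ℕ.+_) (deg-· u v) ⟩
  a ℕ.+ b ℕ.+ (deg u ℕ.+ deg v)   ≡⟨ ℕ.+-assoc a b _ ⟩
  a ℕ.+ (b ℕ.+ (deg u ℕ.+ deg v)) ≡⟨ cong (a ℕ.+_) (sym (ℕ.+-assoc b (deg u) (deg v))) ⟩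
  a ℕ.+ (b ℕ.+ deg u ℕ.+ deg v)   ≡⟨ cong (λ w → a ℕ.+ (w ℕ.+ deg v)) (ℕ.+-comm b (deg u)) ⟩
  a ℕ.+ (deg u ℕ.+ b ℕ.+ deg v)   ≡⟨ cong (a ℕ.+_) (ℕ.+-assoc (deg u) b (deg v)) ⟩
  a ℕ.+ (deg u ℕ.+ (b ℕ.+ deg v)) ≡⟨ sym (ℕ.+-assoc a (deg u) _) ⟩
  a ℕ.+ deg u ℕ.+ (b ℕ.+ deg v)   ∎
  where open ≡-Reasoning

-- Degree reverse lexicographic order with x > y > z: in equal degree, t′ > t
-- when the last nonzero entry of t′ - t is negative.
infix 4 _>DegRevLex_
_>DegRevLex_ : Rel Monomial _
t′ >DegRevLex t =
  (deg t ℕ.< deg t′) ⊎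
  (deg t′ ≡ deg t ×
   ∃[ k ] (lookup t′ k ℕ.< lookup t k ×
           (∀ j → k Fin.< j → lookup t′ j ≡ lookup t j)))

-- Fields are the library's Heyting fields.  A classical field is a Heyting
-- field with x # y given by ¬ (x ≈ y), and classically there are no others.
module Polynomials {c ℓ₁ ℓ₂} (K : HeytingField c ℓ₁ ℓ₂) where

  open HeytingField K using (Carrier; heytingCommutativeRing)
    renaming (_≈_ to _≈ᴷ_; _+_ to _+ᴷ_; _*_ to _*ᴷ_; -_ to -ᴷ_; 0# to 0ᴷ; 1# to 1ᴷ)

  private
    module R = CommutativeRing
      (HeytingCommutativeRing.commutativeRing heytingCommutativeRing)

  CharacteristicZero : Set ℓ₁
  CharacteristicZero = ∀ n → ¬ (suc n ×ᴷ 1ᴷ ≈ᴷ 0ᴷ)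
    where open RawMonoidDefs R.+-rawMonoid using () renaming (_×_ to _×ᴷ_)

  -- S = K[x,y,z]: formal sums of terms a·u, two of which are equal when every
  -- power-product has the same total coefficient in both.
  Poly : Set c
  Poly = List (Carrier × Monomial)

  coeff : Poly → Monomial → Carrier
  coeff []            m = 0ᴷ
  coeff ((a , u) ∷ f) m = (if does (u ≟ᵐ m) then a else 0ᴷ) +ᴷ coeff f m

  infix 4 _≈_
  _≈_ : Rel Poly ℓ₁
  f ≈ g = ∀ m → coeff f m ≈ᴷ coeff g m

  infixl 6 _+_ _-_
  infixl 7 _*_

  0ₚ : Poly
  0ₚ = []

  _+_ : Poly → Poly → Poly
  _+_ = _++_

  _*ᵗ_ : Carrier × Monomial → Carrier × Monomial → Carrier × Monomial
  (a , u) *ᵗ (b , v) = a *ᴷ b , u · v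

  _*_ : Poly → Poly → Poly
  _*_ = cartesianProductWith _*ᵗ_

  -ₚ_ : Poly → Poly
  -ₚ_ = map (λ (a , u) → -ᴷ a , u)

  _-_ : Poly → Poly → Poly
  f - g = f + (-ₚ g)

  pp : Monomial → Poly
  pp t = [ (1ᴷ , t) ]

  record Ideal p : Set (c ⊔ ℓ₁ ⊔ lsuc p) where
    field
      ⟦_⟧    : Pred Poly p
      ∈-resp : ∀ {f g} → f ≈ g → f ∈ ⟦_⟧ → g ∈ ⟦_⟧
      0-∈    : 0ₚ ∈ ⟦_⟧
      +-∈    : ∀ {f g} → f ∈ ⟦_⟧ → g ∈ ⟦_⟧ → f + g ∈ ⟦_⟧
      *-∈    : ∀ h {f} → f ∈ ⟦_⟧ → h * f ∈ ⟦_⟧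

  open Ideal public using (⟦_⟧)

  ⟨_⟩ : ∀ {p} → Pred Monomial p → Pred Poly (c ⊔ ℓ₁ ⊔ p)
  ⟨ G ⟩ f = Σ (List (Poly × ∃ G)) λ hs →
    f ≈ foldr (λ (h , t , _) acc → h * pp t + acc) 0ₚ hs

  Generates : ∀ {p q} → Pred Monomial q → Ideal p → Set (c ⊔ ℓ₁ ⊔ p ⊔ q)
  Generates G I = ⟦ I ⟧ ≐ ⟨ G ⟩

  IsMonomialIdeal : ∀ {p} → Ideal p → Set (c ⊔ ℓ₁ ⊔ lsuc p)
  IsMonomialIdeal {p} I = Σ (Pred Monomial p) λ G → Generates G I

  -- The power-product t with xⱼ ∣ t is written xⱼ·u, so u is t/xⱼ.
  record StronglyStable {p} (I : Ideal p) : Set (c ⊔ ℓ₁ ⊔ lsuc p) where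
    field
      isMonomial : IsMonomialIdeal I
      exchange   : ∀ t u {i j} → i Fin.< j → t ≡ var j · u →
                   pp t ∈ ⟦ I ⟧ → pp (var i · u) ∈ ⟦ I ⟧

  record IsMinimalGeneratingSet {p} (G : Pred Monomial p) (I : Ideal p)
         : Set (c ⊔ ℓ₁ ⊔ lsuc p) where
    field
      generates : Generates G I
      minimal   : (G′ : Pred Monomial p) → G′ ⊆ G → Generates G′ I → G ⊆ G′

  -- The minimal generating set of a monomial ideal exists and is unique, so
  -- quantifying it existentially or universally makes no difference.
  AlmostRevlex : ∀ {p} → Ideal p → Set (c ⊔ ℓ₁ ⊔ lsuc p)
  AlmostRevlex {p} I = Σ (Pred Monomial p) λ G →
    IsMinimalGeneratingSet G I ×
    (∀ t t′ → t ∈ G → deg t′ ≡ deg t → t′ >DegRevLex t → pp t′ ∈ ⟦ I ⟧)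

  -- The homogeneous part S_d, presented by formal sums all of whose terms have
  -- degree d; each polynomial lying in S_d is ≈ to such a sum.
  Form : ℕ → Set c
  Form d = Σ Poly (All (λ (_ , u) → deg u ≡ d))

  *-homogeneous : ∀ {d e f g} → All (λ (_ , u) → deg u ≡ d) f →
                  All (λ (_ , v) → deg v ≡ e) g →
                  All (λ (_ , w) → deg w ≡ d ℕ.+ e) (f * g)
  *-homogeneous []                       hg = []
  *-homogeneous {f = (a , u) ∷ _} (p ∷ hf) hg = ++⁺ (row hg) (*-homogeneous hf hg)
    where
    row : ∀ {g} → All _ g → All _ (map ((a , u) *ᵗ_) g)
    row []                        = []
    row {(_ , v) ∷ _} (q ∷ hg′) = trans (deg-· u v) (cong₂ ℕ._+_ p q) ∷ row hg′

  infixl 6 _+ᶠ_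
  infixl 7 _*ᶠ_ _•ᶠ_
  infixr 8 _^ᶠ_

  0ᶠ : ∀ {d} → Form d
  0ᶠ = 0ₚ , []

  1ᶠ : Form 0
  1ᶠ = pp 𝟙 , refl ∷ []

  _+ᶠ_ : ∀ {d} → Form d → Form d → Form d
  (f , hf) +ᶠ (g , hg) = f + g , ++⁺ hf hg

  _*ᶠ_ : ∀ {d e} → Form d → Form e → Form (d ℕ.+ e)
  (f , hf) *ᶠ (g , hg) = f * g , *-homogeneous hf hg

  _•ᶠ_ : ∀ {d} → Carrier → Form d → Form d
  a •ᶠ f = ((a , 𝟙) ∷ [] , refl ∷ []) *ᶠ f

  _^ᶠ_ : Form 1 → ∀ s → Form s
  l ^ᶠ zero  = 1ᶠ
  l ^ᶠ suc s = l *ᶠ l ^ᶠ s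

  -- Elements of R_d, for R = S/I, are forms of degree d up to congruence mod I.
  infix 4 _≈[_]_
  _≈[_]_ : ∀ {p d} → Form d → Ideal p → Form d → Set p
  (f , _) ≈[ I ] (g , _) = f - g ∈ ⟦ I ⟧

  linearCombination : ∀ {d n} → (Fin n → Carrier) → (Fin n → Form d) → Form d
  linearCombination a v = Vector.foldr _+ᶠ_ 0ᶠ (Vector.zipWith _•ᶠ_ a v)

  record HasDimension {p} (I : Ideal p) (d n : ℕ) : Set (c ⊔ ℓ₁ ⊔ p) where
    field
      basis       : Fin n → Form d
      spanning    : ∀ f → ∃[ a ] (linearCombination a basis ≈[ I ] f)
      independent : ∀ a → linearCombination a basis ≈[ I ] 0ᶠ → ∀ k → a k ≈ᴷ 0ᴷ

  IsHilbertFunction : ∀ {p} → Ideal p → (ℕ → ℕ) → Set (c ⊔ ℓ₁ ⊔ p)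
  IsHilbertFunction I H = ∀ i → HasDimension I i (H i)

  SameHilbertFunction : ∀ {p q} → Ideal p → Ideal q → Set (c ⊔ ℓ₁ ⊔ p ⊔ q)
  SameHilbertFunction I I′ = ∃[ H ] (IsHilbertFunction I H × IsHilbertFunction I′ H)

  multiplyBy : Form 1 → ∀ s i → Form i → Form (i ℕ.+ s)
  multiplyBy l s i f = f *ᶠ l ^ᶠ s

  FullRank : ∀ {p} → Ideal p → Form 1 → ∀ s i → Set (c ⊔ p)
  FullRank I l s i =
    Injective  _≈[ I ]_ _≈[ I ]_ (multiplyBy l s i) ⊎
    Surjective _≈[ I ]_ _≈[ I ]_ (multiplyBy l s i)

  -- The strong Lefschetz property of S/I.
  record SLP {p} (I : Ideal p) : Set (c ⊔ ℓ₁ ⊔ p) where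
    field
      finiteDimensional : ∀ i → ∃[ n ] HasDimension I i n
      element           : Form 1
      fullRank          : ∀ i s → 1 ℕ.≤ s → FullRank I element s i

{-# OPTIONS --safe #-}
module Submission where

-- A strongly stable ideal I is monomial, so everything is read off from the set
-- of power-products in it, and strong stability says that this set is closed
-- under replacing z by y and y by x.  Let l be the Lefschetz element.
--
-- If multiplication by l^s is injective in degree i of S/I, then u z^s in I with
-- deg u = i forces u in I: by strong stability u w is in I for every w of degree
-- s, hence so is u l^s.  If it is surjective, then y^(i+1) z^(s-1) is in I.
-- Otherwise the i+2 power-products y^k z^(i+s-k) with k at most i+1 are all
-- outside I, although modulo x their span would have to be covered by the image
-- of the space of forms of degree i in y and z, which has dimension i+1.
--
-- Let t = x^a y^b z^c be a minimal generator and t′ a larger power-product of the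
-- same degree.  If z has exponent c in t′ as well, then t′ arises from t by
-- replacing copies of y by x.  Otherwise c > 0 and t/z is not in I, so neither
-- is x^a y^b, and multiplication by l^c is not injective in degree a+b.  Hence
-- y^(a+b+1) z^(c-1) is in I (lefschetz), and t′ arises from it by replacements.
-- So I is almost revlex (minimalGenerator-revlex).
--
-- Two such ideals I and J with the same Hilbert function agree by induction on
-- the degree.  If they agree below degree d, then t in I but not J and t′ in J
-- but not I of degree d would be minimal generators, and the larger one would
-- lie in both ideals (comparable).  So in degree d one ideal contains the other,
-- and equality follows from equality of dimensions (sameDimension⇒⊇).
--
-- The field is a Heyting field, so two points need constructive care.  Membership
-- of a power-product in I is decidable because S/I has a finite basis in each
-- degree (∈?-deg), and the comparisons of dimension rest on the fact that n+1
-- vectors with n coordinates are not independent (¬-independent).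

open import Defs
open import Algebra.Apartness.Bundles using (HeytingField; HeytingCommutativeRing)
open import Algebra.Bundles using (CommutativeRing)
import Algebra.Apartness.Properties.HeytingCommutativeRing as HeytingProperties
import Algebra.Properties.Ring as RingProperties
import Algebra.Properties.Semiring.Sum as SemiringSum
open import Data.Bool.Base using (if_then_else_)
open import Data.Empty using (⊥)
open import Data.Fin.Base using (Fin; zero; suc; toℕ; fromℕ<; punchIn; punchOut)
open import Data.Fin.Properties using (punchInᵢ≢i; punchIn-punchOut)
import Data.Fin.Properties as Fin
open import Data.List.Base as List using ([]; _∷_; map; foldr)
open import Data.List.Relation.Unary.All as All using (All; []; _∷_)
open import Data.List.Relation.Unary.All.Properties using (++⁺; map⁺)
open import Data.List.Relation.Unary.Any using (Any; here; there)
open import Data.Nat.Base as ℕ using (ℕ; zero; suc; _∸_; s≤s; z≤n)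
open import Data.Nat.Tactic.RingSolver using (solve)
open import Data.Product.Base using (_×_; _,_; proj₁; proj₂; ∃-syntax)
open import Data.Sum.Base using (_⊎_; inj₁; inj₂)
open import Data.Vec.Base using ([]; _∷_; lookup)
open import Data.Vec.Properties using (zipWith-assoc)
import Data.Vec.Functional as Vector
open import Function.Base using (_∘_)
open import Function.Definitions using (Injective; Surjective)
open import Level using (Level)
open import Relation.Binary.Definitions using (tri<; tri≈; tri>)
import Relation.Binary.PropositionalEquality as ≡
open ≡ using (_≡_; _≢_)
import Relation.Binary.Reasoning.Setoid as SetoidReasoning
open import Relation.Nullary.Decidable.Core using (Dec; yes; no; does; map′; decidable-stable; ¬¬-excluded-middle)
open import Relation.Nullary.Negation.Core using (¬_; contradiction)
open import Relation.Unary using (Pred; _∈_; _⊆_; _≐_)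

-- Linear algebra over a Heyting field

module LinearAlgebra {c ℓ₁ ℓ₂ : Level} (K : HeytingField c ℓ₁ ℓ₂) where

  open HeytingField K using (heytingCommutativeRing; _#_; #-cotrans; #⇒invertible; tight)

  commutativeRing : CommutativeRing c ℓ₁
  commutativeRing = HeytingCommutativeRing.commutativeRing heytingCommutativeRing

  open CommutativeRing commutativeRing hiding (zero)
  open HeytingProperties heytingCommutativeRing using (1#0; #-congʳ; x-0≈x; invertibleˡ⇒#)
  open RingProperties ring using (-‿distribˡ-*)
  open SemiringSum semiring using (sum; sum-cong-≋; sum-replicate-zero; sum-remove; ∑-distrib-+; ∑-comm;
    *-distribˡ-sum; *-distribʳ-sum)
  open SetoidReasoning setoid

  1≉0 : ¬ 1# ≈ 0#
  1≉0 1≈0 = proj₂ (tight 1# 0#) 1≈0 1#0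

  ¬#0⇒≈0 : ∀ {x} → ¬ x # 0# → x ≈ 0#
  ¬#0⇒≈0 = proj₁ (tight _ _)

  #0⇒≉0 : ∀ {x} → x # 0# → ¬ x ≈ 0#
  #0⇒≉0 x#0 x≈0 = proj₂ (tight _ _) x≈0 x#0

  #⇒-#0 : ∀ {x y} → x # y → x - y # 0#
  #⇒-#0 {x} {y} x#y with #⇒invertible x#y
  ... | w , w[x-y]≈1 , _ = invertibleˡ⇒# (w , trans (*-congˡ (x-0≈x (x - y))) w[x-y]≈1)

  +#0⇒#0⊎#0 : ∀ {x y} → x + y # 0# → x # 0# ⊎ y # 0#
  +#0⇒#0⊎#0 {x} {y} x+y#0 with #-cotrans x+y#0 y
  ... | inj₂ y#0 = inj₂ y#0
  ... | inj₁ x+y#y = inj₁ (#-congʳ x+y-y≈x (#⇒-#0 x+y#y))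
    where
    x+y-y≈x : x + y - y ≈ x
    x+y-y≈x = trans (+-assoc x y (- y)) (trans (+-congˡ (-‿inverseʳ y)) (+-identityʳ x))

  *≈0⇒≈0 : ∀ {x y} → y # 0# → x * y ≈ 0# → x ≈ 0#
  *≈0⇒≈0 {x} {y} y#0 xy≈0 with #⇒invertible y#0
  ... | w , _ , [y-0]w≈1 = begin
    x                 ≈⟨ *-identityʳ x ⟨
    x * 1#            ≈⟨ *-congˡ [y-0]w≈1 ⟨
    x * ((y - 0#) * w) ≈⟨ *-congˡ (*-congʳ (x-0≈x y)) ⟩
    x * (y * w)       ≈⟨ *-assoc x y w ⟨
    x * y * w         ≈⟨ *-congʳ xy≈0 ⟩
    0# * w            ≈⟨ zeroˡ w ⟩
    0#                ∎

  ∑-zero : ∀ {n} {f : Fin n → Carrier} → (∀ i → f i ≈ 0#) → sum f ≈ 0#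
  ∑-zero {n} f≈0 = trans (sum-cong-≋ {n} f≈0) (sum-replicate-zero n)

  ∑-single : ∀ {n} (f : Fin n → Carrier) i → (∀ k → k ≢ i → f k ≈ 0#) → sum f ≈ f i
  ∑-single {suc n} f i f≈0 = begin
    sum f                          ≈⟨ sum-remove {i = i} f ⟩
    f i + sum (Vector.removeAt f i) ≈⟨ +-congˡ (∑-zero {n} λ j → f≈0 (punchIn i j) (punchInᵢ≢i i j)) ⟩
    f i + 0#                       ≈⟨ +-identityʳ (f i) ⟩
    f i                            ∎

  -- A is the matrix whose rows A i are the vectors in question.
  Independent : ∀ {m n} → (Fin m → Fin n → Carrier) → Set _
  Independent {m} A = ∀ (c : Fin m → Carrier) → (∀ j → sum (λ i → c i * A i j) ≈ 0#) → ∀ i → c i ≈ 0#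

  -- If c is a relation between the rows of A, it is one between the rows of A B.
  relation-* : ∀ {m n} (c : Fin m → Carrier) (A : Fin m → Fin n → Carrier) (b : Fin n → Carrier) →
               (∀ j → sum (λ i → c i * A i j) ≈ 0#) →
               sum (λ i → c i * sum (λ j → A i j * b j)) ≈ 0#
  relation-* {m} {n} c A b cA≈0 = begin
    sum (λ i → c i * sum (λ j → A i j * b j))   ≈⟨ sum-cong-≋ {m} (λ i → *-distribˡ-sum {n} (c i) _) ⟩
    sum (λ i → sum (λ j → c i * (A i j * b j))) ≈⟨ ∑-comm {m} {n} _ ⟩
    sum (λ j → sum (λ i → c i * (A i j * b j))) ≈⟨ ∑-zero {n} column ⟩
    0#                                          ∎
    where
    column : ∀ j → sum (λ i → c i * (A i j * b j)) ≈ 0#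
    column j = begin
      sum (λ i → c i * (A i j * b j)) ≈⟨ sum-cong-≋ {m} (λ i → *-assoc (c i) (A i j) (b j)) ⟨
      sum (λ i → c i * A i j * b j)   ≈⟨ *-distribʳ-sum {m} (b j) _ ⟨
      sum (λ i → c i * A i j) * b j   ≈⟨ *-congʳ (cA≈0 j) ⟩
      0# * b j                        ≈⟨ zeroˡ (b j) ⟩
      0#                              ∎

  -- The effect on a combination of the rows of clearing a column.
  ∑-collect : ∀ {m} (c v w : Fin m → Carrier) x y →
              sum (λ i → c i * v i) * x + sum (λ i → c i * y * w i) ≈
              sum (λ i → c i * (v i * x + y * w i))
  ∑-collect {m} c v w x y = begin
    sum (λ i → c i * v i) * x + sum (λ i → c i * y * w i)       ≈⟨ +-congʳ (*-distribʳ-sum {m} x _) ⟩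
    sum (λ i → c i * v i * x) + sum (λ i → c i * y * w i)       ≈⟨ ∑-distrib-+ {m} _ _ ⟨
    sum (λ i → c i * v i * x + c i * y * w i)                   ≈⟨ sum-cong-≋ {m} (λ i → +-cong (*-assoc _ _ _) (*-assoc _ _ _)) ⟩
    sum (λ i → c i * (v i * x) + c i * (y * w i))               ≈⟨ sum-cong-≋ {m} (λ i → distribˡ _ _ _) ⟨
    sum (λ i → c i * (v i * x + y * w i))                       ∎

  -- More vectors than coordinates are never independent.  The proof is
  -- Gaussian elimination; as it derives a contradiction, whether the first row
  -- has an invertible entry may be decided classically.
  ¬-independent : ∀ n (A : Fin (suc n) → Fin n → Carrier) → ¬ Independent A
  ¬-independent zero    A ind = 1≉0 (ind (λ _ → 1#) (λ ()) zero)
  ¬-independent (suc n) A ind = ¬¬-excluded-middle λ where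
      (no ¬pivot)      → zeroRow ¬pivot
      (yes (p , A₀ₚ#0)) → eliminate p A₀ₚ#0
    where
    zeroRow : ¬ (∃[ p ] A zero p # 0#) → ⊥
    zeroRow ¬pivot = 1≉0 (ind e₀ e₀A≈0 zero)
      where
      e₀ : Fin (suc (suc n)) → Carrier
      e₀ zero    = 1#
      e₀ (suc _) = 0#
      e₀A≈0 : ∀ j → sum (λ i → e₀ i * A i j) ≈ 0#
      e₀A≈0 j = trans
        (+-cong (trans (*-identityˡ _) (¬#0⇒≈0 λ A₀ⱼ#0 → ¬pivot (j , A₀ⱼ#0)))
                (∑-zero {suc n} λ i → zeroˡ (A (suc i) j)))
        (+-identityˡ 0#)

    -- Clear column p of the lower rows with the pivot in position (0 , p), then
    -- drop that row and that column.
    eliminate : ∀ p → A zero p # 0# → ⊥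
    eliminate p A₀ₚ#0 = ¬-independent n (λ i j → cleared i (punchIn p j)) cleared-independent
      where
      cleared : Fin (suc n) → Fin (suc n) → Carrier
      cleared i j = (- A (suc i) p) * A zero j + A zero p * A (suc i) j

      cleared-p : ∀ i → cleared i p ≈ 0#
      cleared-p i = begin
        (- A (suc i) p) * A zero p + A zero p * A (suc i) p   ≈⟨ +-congʳ (-‿distribˡ-* _ _) ⟨
        - (A (suc i) p * A zero p) + A zero p * A (suc i) p   ≈⟨ +-congˡ (*-comm _ _) ⟩
        - (A (suc i) p * A zero p) + A (suc i) p * A zero p   ≈⟨ -‿inverseˡ _ ⟩
        0#                                                    ∎

      cleared-independent : Independent (λ i j → cleared i (punchIn p j))
      cleared-independent c c-cleared≈0 i = *≈0⇒≈0 A₀ₚ#0 (ind d dA≈0 (suc i))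
        where
        d : Fin (suc (suc n)) → Carrier
        d zero    = sum (λ i → c i * (- A (suc i) p))
        d (suc i) = c i * A zero p

        expand : ∀ j → sum (λ i → d i * A i j) ≈ sum (λ i → c i * cleared i j)
        expand j = ∑-collect c (λ i → - A (suc i) p) (λ i → A (suc i) j) (A zero j) (A zero p)

        dA≈0 : ∀ j → sum (λ i → d i * A i j) ≈ 0#
        dA≈0 j with p Fin.≟ j
        ... | yes ≡.refl = trans (expand p) (∑-zero {suc n} λ i → trans (*-congˡ (cleared-p i)) (zeroʳ (c i)))
        ... | no p≢j = ≡.subst (λ k → sum (λ i → d i * A i k) ≈ 0#) (punchIn-punchOut p≢j)
                         (trans (expand _) (c-cleared≈0 (punchOut p≢j)))

-- Coefficients of polynomials

module Coefficients {c ℓ₁ ℓ₂ : Level} (K : HeytingField c ℓ₁ ℓ₂) where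

  open HeytingField K using (Carrier; _#_; #-sym; #-cotrans; heytingCommutativeRing)
  open LinearAlgebra K
  open CommutativeRing commutativeRing hiding (Carrier; zero)
    renaming (_≈_ to _≈ᴷ_; _+_ to _+ᴷ_; _*_ to _*ᴷ_; -_ to -ᴷ_; _-_ to _-ᴷ_; 0# to 0ᴷ; 1# to 1ᴷ)
  open HeytingProperties heytingCommutativeRing using (1#0; #-congʳ)
  open RingProperties ring using (-0#≈0#; -‿+-comm; x∙y⁻¹≈ε⇒x≈y)
  open SemiringSum semiring using (sum; sum-cong-≋; ∑-distrib-+)
  open SetoidReasoning setoid
  open Polynomials K

  -- The coefficient of m in the single term a u.
  entry : Carrier → Monomial → Monomial → Carrier
  entry a u m = if does (u ≟ᵐ m) then a else 0ᴷ

  entry-≡ : ∀ a {u m} → u ≡ m → entry a u m ≈ᴷ a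
  entry-≡ a {u} {m} u≡m with u ≟ᵐ m
  ... | yes _  = refl
  ... | no u≢m = contradiction u≡m u≢m

  entry-≢ : ∀ a {u m} → u ≢ m → entry a u m ≈ᴷ 0ᴷ
  entry-≢ a {u} {m} u≢m with u ≟ᵐ m
  ... | yes u≡m = contradiction u≡m u≢m
  ... | no _    = refl

  entry-scale : ∀ a b c u m → c ≈ᴷ a *ᴷ b → entry c u m ≈ᴷ a *ᴷ entry b u m
  entry-scale a b c u m c≈ab with u ≟ᵐ m
  ... | yes _ = c≈ab
  ... | no _  = sym (zeroʳ a)

  coeff-pp-≡ : ∀ {u m} → u ≡ m → coeff (pp u) m ≈ᴷ 1ᴷ
  coeff-pp-≡ u≡m = trans (+-identityʳ _) (entry-≡ 1ᴷ u≡m)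

  coeff-pp-≢ : ∀ {u m} → u ≢ m → coeff (pp u) m ≈ᴷ 0ᴷ
  coeff-pp-≢ u≢m = trans (+-identityʳ _) (entry-≢ 1ᴷ u≢m)

  coeff-pp#0 : ∀ u → coeff (pp u) u # 0ᴷ
  coeff-pp#0 u = #-congʳ (sym (coeff-pp-≡ {u} ≡.refl)) 1#0

  coeff-+ : ∀ f g m → coeff (f + g) m ≈ᴷ coeff f m +ᴷ coeff g m
  coeff-+ []            g m = sym (+-identityˡ _)
  coeff-+ ((a , u) ∷ f) g m = trans (+-congˡ (coeff-+ f g m)) (sym (+-assoc _ _ _))

  coeff-neg : ∀ f m → coeff (-ₚ f) m ≈ᴷ -ᴷ coeff f m
  coeff-neg []            m = sym -0#≈0#
  coeff-neg ((a , u) ∷ f) m = trans (+-cong entry-neg (coeff-neg f m)) (-‿+-comm _ _)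
    where
    entry-neg : entry (-ᴷ a) u m ≈ᴷ -ᴷ entry a u m
    entry-neg with u ≟ᵐ m
    ... | yes _ = refl
    ... | no _  = sym -0#≈0#

  coeff-- : ∀ f g m → coeff (f - g) m ≈ᴷ coeff f m -ᴷ coeff g m
  coeff-- f g m = trans (coeff-+ f (-ₚ g) m) (+-congˡ (coeff-neg g m))

  -- u ▹ g is the product of the power-product u with g.
  infixr 7 _▹_
  _▹_ : Monomial → Poly → Poly
  u ▹ g = map ((1ᴷ , u) *ᵗ_) g

  coeff-map : ∀ a u g m → coeff (map ((a , u) *ᵗ_) g) m ≈ᴷ a *ᴷ coeff (u ▹ g) m
  coeff-map a u []            m = sym (zeroʳ a)
  coeff-map a u ((b , v) ∷ g) m = begin
    entry (a *ᴷ b) (u · v) m +ᴷ coeff (map ((a , u) *ᵗ_) g) m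
      ≈⟨ +-cong (entry-scale a (1ᴷ *ᴷ b) (a *ᴷ b) (u · v) m (*-congˡ (sym (*-identityˡ b)))) (coeff-map a u g m) ⟩
    a *ᴷ entry (1ᴷ *ᴷ b) (u · v) m +ᴷ a *ᴷ coeff (u ▹ g) m
      ≈⟨ distribˡ _ _ _ ⟨
    a *ᴷ coeff (u ▹ ((b , v) ∷ g)) m ∎

  -- The value at f of the linear functional that takes each power-product u to φ u.
  eval : (Monomial → Carrier) → Poly → Carrier
  eval φ []            = 0ᴷ
  eval φ ((a , u) ∷ f) = a *ᴷ φ u +ᴷ eval φ f

  coeff-* : ∀ f g m → coeff (f * g) m ≈ᴷ eval (λ u → coeff (u ▹ g) m) f
  coeff-* []            g m = refl
  coeff-* ((a , u) ∷ f) g m = trans (coeff-+ (map ((a , u) *ᵗ_) g) (f * g) m)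
                                    (+-cong (coeff-map a u g m) (coeff-* f g m))

  ·-identityˡ : ∀ u → 𝟙 · u ≡ u
  ·-identityˡ (x ∷ y ∷ z ∷ []) = ≡.refl

  coeff-𝟙▹ : ∀ g m → coeff (𝟙 ▹ g) m ≈ᴷ coeff g m
  coeff-𝟙▹ []            m = refl
  coeff-𝟙▹ ((b , v) ∷ g) m rewrite ·-identityˡ v =
    +-cong (trans (entry-scale 1ᴷ b (1ᴷ *ᴷ b) v m refl) (*-identityˡ _)) (coeff-𝟙▹ g m)

  coeff-scale : ∀ a f m → coeff (((a , 𝟙) ∷ []) * f) m ≈ᴷ a *ᴷ coeff f m
  coeff-scale a f m = begin
    coeff (((a , 𝟙) ∷ []) * f) m        ≈⟨ coeff-* ((a , 𝟙) ∷ []) f m ⟩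
    a *ᴷ coeff (𝟙 ▹ f) m +ᴷ 0ᴷ          ≈⟨ +-identityʳ _ ⟩
    a *ᴷ coeff (𝟙 ▹ f) m                ≈⟨ *-congˡ (coeff-𝟙▹ f m) ⟩
    a *ᴷ coeff f m                      ∎

  coeff-linearCombination : ∀ {d n} (a : Fin n → Carrier) (v : Fin n → Form d) m →
    coeff (proj₁ (linearCombination a v)) m ≈ᴷ sum (λ k → a k *ᴷ coeff (proj₁ (v k)) m)
  coeff-linearCombination {n = zero}  a v m = refl
  coeff-linearCombination {n = suc n} a v m =
    trans (coeff-+ (proj₁ (a zero •ᶠ v zero)) _ m)
          (+-cong (coeff-scale (a zero) (proj₁ (v zero)) m)
                  (coeff-linearCombination (a ∘ suc) (v ∘ suc) m))

  coeff#0⇒Any : ∀ f m → coeff f m # 0ᴷ → Any (λ (_ , u) → u ≡ m) f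
  coeff#0⇒Any []            m 0#0 = contradiction refl (#0⇒≉0 0#0)
  coeff#0⇒Any ((a , u) ∷ f) m c#0 with u ≟ᵐ m
  ... | yes u≡m = here u≡m
  ... | no _    = there (coeff#0⇒Any f m (#-congʳ (+-identityˡ _) c#0))

  coeff#0⇒deg : ∀ {d} (f : Form d) m → coeff (proj₁ f) m # 0ᴷ → deg m ≡ d
  coeff#0⇒deg (f , hf) m c#0 = go hf (coeff#0⇒Any f m c#0)
    where
    go : ∀ {d f} → All (λ (_ , u) → deg u ≡ d) f → Any (λ (_ , u) → u ≡ m) f → deg m ≡ d
    go (du ∷ _) (here ≡.refl) = du
    go (_ ∷ hf) (there i)     = go hf i

  -- A power-product with nonzero coefficient in an element of the ideal
  -- generated by G is divisible by an element of G.
  ⟨⟩-divisor : ∀ {q} {G : Pred Monomial q} {f} → f ∈ ⟨ G ⟩ → ∀ m → coeff f m # 0ᴷ →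
               ∃[ g ] ∃[ w ] (G g × m ≡ w · g)
  ⟨⟩-divisor {G = G} (hs , f≈) m c#0 = go hs (#-congʳ (f≈ m) c#0)
    where
    factor : ∀ h t → Any (λ (_ , u) → u ≡ m) (h * pp t) → ∃[ w ] m ≡ w · t
    factor ((_ , w) ∷ h) t (here w·t≡m) = w , ≡.sym w·t≡m
    factor (_ ∷ h)       t (there i)    = factor h t i

    go : ∀ hs → coeff (foldr (λ (h , t , _) acc → h * pp t + acc) 0ₚ hs) m # 0ᴷ →
         ∃[ g ] ∃[ w ] (G g × m ≡ w · g)
    go []                c#0 = contradiction refl (#0⇒≉0 c#0)
    go ((h , t , Gt) ∷ hs) c#0 with +#0⇒#0⊎#0 (#-congʳ (coeff-+ (h * pp t) _ m) c#0)
    ... | inj₁ c#0 = let w , m≡w·t = factor h t (coeff#0⇒Any (h * pp t) m c#0) in t , w , Gt , m≡w·t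
    ... | inj₂ c#0 = go hs c#0

  ⟨⟩-generator : ∀ {q} {G : Pred Monomial q} {t} → G t → pp t ∈ ⟨ G ⟩
  ⟨⟩-generator {t = t} Gt = (pp 𝟙 , t , Gt) ∷ [] , λ m → sym (begin
    coeff (pp 𝟙 * pp t + 0ₚ) m          ≈⟨ coeff-+ (pp 𝟙 * pp t) 0ₚ m ⟩
    coeff (pp 𝟙 * pp t) m +ᴷ 0ᴷ         ≈⟨ +-identityʳ _ ⟩
    coeff (pp 𝟙 * pp t) m               ≈⟨ coeff-scale 1ᴷ (pp t) m ⟩
    1ᴷ *ᴷ coeff (pp t) m                ≈⟨ *-identityˡ _ ⟩
    coeff (pp t) m                      ∎)

  -- A polynomial all of whose terms are divisible by elements of G lies in the
  -- ideal generated by G.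
  All⇒⟨⟩ : ∀ {q} {G : Pred Monomial q} f →
           All (λ (_ , u) → ∃[ g ] ∃[ w ] (G g × u ≡ w · g)) f → f ∈ ⟨ G ⟩
  All⇒⟨⟩ []            []                        = [] , λ m → refl
  All⇒⟨⟩ ((a , u) ∷ f) ((g , w , Gg , ≡.refl) ∷ hf) with All⇒⟨⟩ f hf
  ... | hs , f≈ = ((a , w) ∷ [] , g , Gg) ∷ hs , λ m →
    +-cong (trans (entry-scale a 1ᴷ a (w · g) m (sym (*-identityʳ a)))
                  (sym (entry-scale a 1ᴷ (a *ᴷ 1ᴷ) (w · g) m refl)))
           (f≈ m)

  -- Membership in ideals

  module Membership {p} (I : Ideal p) where

    open Ideal I using (∈-resp; 0-∈; +-∈; *-∈)

    scale-∈ : ∀ a {f} → f ∈ ⟦ I ⟧ → ((a , 𝟙) ∷ []) * f ∈ ⟦ I ⟧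
    scale-∈ a = *-∈ ((a , 𝟙) ∷ [])

    term-∈ : ∀ a {u} → pp u ∈ ⟦ I ⟧ → (a , u) ∷ [] ∈ ⟦ I ⟧
    term-∈ a {u} u∈I = ∈-resp (λ m → trans (coeff-scale a (pp u) m) (rescale m)) (scale-∈ a u∈I)
      where
      rescale : ∀ m → a *ᴷ (entry 1ᴷ u m +ᴷ 0ᴷ) ≈ᴷ entry a u m +ᴷ 0ᴷ
      rescale m = begin
        a *ᴷ (entry 1ᴷ u m +ᴷ 0ᴷ) ≈⟨ *-congˡ (+-identityʳ _) ⟩
        a *ᴷ entry 1ᴷ u m         ≈⟨ entry-scale a 1ᴷ a u m (sym (*-identityʳ a)) ⟨
        entry a u m               ≈⟨ +-identityʳ _ ⟨
        entry a u m +ᴷ 0ᴷ         ∎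

    All-∈ : ∀ {f} → All (λ (_ , u) → pp u ∈ ⟦ I ⟧) f → f ∈ ⟦ I ⟧
    All-∈ []                       = 0-∈
    All-∈ {(a , u) ∷ f} (u∈I ∷ f∈I) = +-∈ (term-∈ a u∈I) (All-∈ f∈I)

    ·-∈ : ∀ v {u} → pp u ∈ ⟦ I ⟧ → pp (v · u) ∈ ⟦ I ⟧
    ·-∈ v {u} u∈I = ∈-resp (λ m → +-congʳ (trans (entry-scale 1ᴷ 1ᴷ _ (v · u) m refl) (*-identityˡ _)))
                           (*-∈ (pp v) u∈I)

    ≈[]-refl : ∀ f → f - f ∈ ⟦ I ⟧
    ≈[]-refl f = ∈-resp (λ m → sym (trans (coeff-- f f m) (-‿inverseʳ _))) 0-∈

    ∈⇒≈[]0 : ∀ {f} → f ∈ ⟦ I ⟧ → f - 0ₚ ∈ ⟦ I ⟧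
    ∈⇒≈[]0 {f} = ∈-resp (λ m → sym (trans (coeff-+ f 0ₚ m) (+-identityʳ _)))

    ≈[]0⇒∈ : ∀ {f} → f - 0ₚ ∈ ⟦ I ⟧ → f ∈ ⟦ I ⟧
    ≈[]0⇒∈ {f} = ∈-resp (λ m → trans (coeff-+ f 0ₚ m) (+-identityʳ _))

    ∈-respˡ : ∀ {f g} → f - g ∈ ⟦ I ⟧ → g ∈ ⟦ I ⟧ → f ∈ ⟦ I ⟧
    ∈-respˡ {f} {g} f-g∈I g∈I = ∈-resp f-g+g≈f (+-∈ f-g∈I g∈I)
      where
      f-g+g≈f : (f - g) + g ≈ f
      f-g+g≈f m = begin
        coeff ((f - g) + g) m                    ≈⟨ coeff-+ (f - g) g m ⟩
        coeff (f - g) m +ᴷ coeff g m             ≈⟨ +-congʳ (coeff-- f g m) ⟩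
        coeff f m -ᴷ coeff g m +ᴷ coeff g m      ≈⟨ +-assoc _ _ _ ⟩
        coeff f m +ᴷ (-ᴷ coeff g m +ᴷ coeff g m) ≈⟨ +-congˡ (-‿inverseˡ _) ⟩
        coeff f m +ᴷ 0ᴷ                          ≈⟨ +-identityʳ _ ⟩
        coeff f m                                ∎

  -- Monomial ideals

  module MonomialIdeal {p} (I : Ideal p) (isMonomial : IsMonomialIdeal I) where

    open Ideal I using (∈-resp; 0-∈; +-∈; *-∈)
    open Membership I

    coeff#0⇒∈ : ∀ {f} → f ∈ ⟦ I ⟧ → ∀ m → coeff f m # 0ᴷ → pp m ∈ ⟦ I ⟧
    coeff#0⇒∈ {f} f∈I m c#0 with ⟨⟩-divisor {f = f} (proj₁ (proj₂ isMonomial) f∈I) m c#0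
    ... | g , w , Gg , ≡.refl = ·-∈ w (proj₂ (proj₂ isMonomial) (⟨⟩-generator Gg))

    ∉⇒coeff≈0 : ∀ {f} → f ∈ ⟦ I ⟧ → ∀ {m} → ¬ pp m ∈ ⟦ I ⟧ → coeff f m ≈ᴷ 0ᴷ
    ∉⇒coeff≈0 f∈I {m} m∉I = ¬#0⇒≈0 λ c#0 → m∉I (coeff#0⇒∈ f∈I m c#0)

    -- Congruent polynomials agree at the power-products outside the ideal.
    ≈[]⇒coeff≈ : ∀ {f g m} → f - g ∈ ⟦ I ⟧ → ¬ pp m ∈ ⟦ I ⟧ → coeff f m ≈ᴷ coeff g m
    ≈[]⇒coeff≈ {f} {g} {m} f-g∈I m∉I =
      x∙y⁻¹≈ε⇒x≈y _ _ (trans (sym (coeff-- f g m)) (∉⇒coeff≈0 f-g∈I m∉I))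

    -- Write t = ∑ aₖ bₖ modulo I in terms of a basis, and let P be the
    -- coefficient of t in ∑ aₖ bₖ.  If P is apart from 1, then ∑ aₖ bₖ - t is an
    -- element of I in which t has a nonzero coefficient, so t is in I.  If P is
    -- apart from 0, then t is not in I, as this would force all aₖ to vanish.
    ∈?-deg : ∀ {d n} → HasDimension I d n → ∀ t → deg t ≡ d → Dec (pp t ∈ ⟦ I ⟧)
    ∈?-deg {d} {n} dim t dt with HasDimension.spanning dim (pp t , dt ∷ [])
    ... | a , f-t∈I = decide (#-cotrans 1#0 P)
      where
      open HasDimension dim
      f : Poly
      f = proj₁ (linearCombination a basis)
      P : Carrier
      P = coeff f t

      coeff-f-t : coeff (f - pp t) t ≈ᴷ P -ᴷ 1ᴷ
      coeff-f-t = trans (coeff-- f (pp t) t) (+-congˡ (-‿cong (coeff-pp-≡ {t} ≡.refl)))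

      P≈0 : pp t ∈ ⟦ I ⟧ → P ≈ᴷ 0ᴷ
      P≈0 t∈I = trans (coeff-linearCombination a basis t)
        (∑-zero {n} λ k → trans (*-congʳ (a≈0 k)) (zeroˡ _))
        where
        a≈0 : ∀ k → a k ≈ᴷ 0ᴷ
        a≈0 = independent a (∈⇒≈[]0 (∈-respˡ {f} f-t∈I t∈I))

      decide : 1ᴷ # P ⊎ P # 0ᴷ → Dec (pp t ∈ ⟦ I ⟧)
      decide (inj₁ 1#P) = yes (coeff#0⇒∈ f-t∈I t (#-congʳ (sym coeff-f-t) (#⇒-#0 (#-sym 1#P))))
      decide (inj₂ P#0) = no λ t∈I → #0⇒≉0 P#0 (P≈0 t∈I)

    module FiniteDimensional (finiteDimensional : ∀ i → ∃[ n ] HasDimension I i n) where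

      infix 4 ∈?_
      ∈?_ : ∀ t → Dec (pp t ∈ ⟦ I ⟧)
      ∈? t = ∈?-deg (proj₂ (finiteDimensional (deg t))) t ≡.refl

      -- The terms of f whose power-products lie in I.
      keep : Poly → Poly
      keep []            = []
      keep ((a , u) ∷ f) with ∈? u
      ... | yes _ = (a , u) ∷ keep f
      ... | no _  = keep f

      keep-All : ∀ f → All (λ (_ , u) → pp u ∈ ⟦ I ⟧) (keep f)
      keep-All []            = []
      keep-All ((a , u) ∷ f) with ∈? u
      ... | yes u∈I = u∈I ∷ keep-All f
      ... | no _    = keep-All f

      coeff-keep-∈ : ∀ f {m} → pp m ∈ ⟦ I ⟧ → coeff (keep f) m ≈ᴷ coeff f m
      coeff-keep-∈ []            m∈I = refl
      coeff-keep-∈ ((a , u) ∷ f) {m} m∈I with ∈? u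
      ... | yes _   = +-congˡ (coeff-keep-∈ f m∈I)
      ... | no u∉I  = trans (coeff-keep-∈ f m∈I)
        (sym (trans (+-congʳ (entry-≢ a {u} {m} λ where ≡.refl → u∉I m∈I)) (+-identityˡ _)))

      coeff-keep-∉ : ∀ f {m} → ¬ pp m ∈ ⟦ I ⟧ → coeff (keep f) m ≈ᴷ 0ᴷ
      coeff-keep-∉ []            m∉I = refl
      coeff-keep-∉ ((a , u) ∷ f) {m} m∉I with ∈? u
      ... | yes u∈I = trans (+-cong (entry-≢ a {u} {m} λ where ≡.refl → m∉I u∈I) (coeff-keep-∉ f m∉I)) (+-identityʳ _)
      ... | no _    = coeff-keep-∉ f m∉I

      keep-≈ : ∀ f → (∀ m → ¬ pp m ∈ ⟦ I ⟧ → coeff f m ≈ᴷ 0ᴷ) → keep f ≈ f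
      keep-≈ f f≈0 m with ∈? m
      ... | yes m∈I = coeff-keep-∈ f m∈I
      ... | no m∉I  = trans (coeff-keep-∉ f m∉I) (sym (f≈0 m m∉I))

      -- With ∉⇒coeff≈0 this characterises I: f is in I exactly if its coefficients
      -- at the power-products outside I vanish.
      coeff≈0⇒∈ : ∀ f → (∀ m → ¬ pp m ∈ ⟦ I ⟧ → coeff f m ≈ᴷ 0ᴷ) → f ∈ ⟦ I ⟧
      coeff≈0⇒∈ f f≈0 = ∈-resp (keep-≈ f f≈0) (All-∈ (keep-All f))

      -- G generates I as soon as it consists of elements of I and each
      -- power-product in I is a multiple of some element of G.
      generates : ∀ {q} {G : Pred Monomial q} → (∀ {g} → G g → pp g ∈ ⟦ I ⟧) →
                  (∀ t → pp t ∈ ⟦ I ⟧ → ∃[ g ] ∃[ w ] (G g × t ≡ w · g)) → Generates G I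
      generates {G = G} G⊆I divisor = I⊆⟨G⟩ , ⟨G⟩⊆I
        where
        I⊆⟨G⟩ : ⟦ I ⟧ ⊆ ⟨ G ⟩
        I⊆⟨G⟩ {f} f∈I with All⇒⟨⟩ (keep f) (All.map (divisor _) (keep-All f))
        ... | hs , keep≈ = hs , λ m → trans (sym (keep-≈ f (λ _ → ∉⇒coeff≈0 f∈I) m)) (keep≈ m)

        sum∈I : ∀ hs → foldr (λ (h , t , _) acc → h * pp t + acc) 0ₚ hs ∈ ⟦ I ⟧
        sum∈I []                  = 0-∈
        sum∈I ((h , t , Gt) ∷ hs) = +-∈ (*-∈ h (G⊆I Gt)) (sum∈I hs)

        ⟨G⟩⊆I : ⟨ G ⟩ ⊆ ⟦ I ⟧
        ⟨G⟩⊆I (hs , f≈) = ∈-resp (λ m → sym (f≈ m)) (sum∈I hs)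

  -- Rank of multiplication maps

  coeff-▹-∤ : ∀ {u m} → (∀ v → u · v ≢ m) → ∀ g → coeff (u ▹ g) m ≈ᴷ 0ᴷ
  coeff-▹-∤ u∤m []            = refl
  coeff-▹-∤ u∤m ((b , v) ∷ g) = trans (+-cong (entry-≢ (1ᴷ *ᴷ b) (u∤m v)) (coeff-▹-∤ u∤m g)) (+-identityʳ _)

  -- A functional that vanishes at the power-products of f not listed by e is
  -- computed from the coefficients of f at those listed by e.
  eval-∑ : ∀ {n} (φ : Monomial → Carrier) (e : Fin n → Monomial) → (∀ {j k} → e j ≡ e k → j ≡ k) →
           ∀ f → All (λ (_ , u) → φ u ≈ᴷ 0ᴷ ⊎ ∃[ b ] e b ≡ u) f →
           eval φ f ≈ᴷ sum (λ b → coeff f (e b) *ᴷ φ (e b))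
  eval-∑ {n} φ e e-injective []            []        = sym (∑-zero {n} λ b → zeroˡ _)
  eval-∑ {n} φ e e-injective ((a , u) ∷ f) (hu ∷ hf) = begin
    a *ᴷ φ u +ᴷ eval φ f
      ≈⟨ +-cong (term hu) (eval-∑ φ e e-injective f hf) ⟩
    sum (λ b → entry a u (e b) *ᴷ φ (e b)) +ᴷ sum (λ b → coeff f (e b) *ᴷ φ (e b))
      ≈⟨ ∑-distrib-+ {n} _ _ ⟨
    sum (λ b → entry a u (e b) *ᴷ φ (e b) +ᴷ coeff f (e b) *ᴷ φ (e b))
      ≈⟨ sum-cong-≋ {n} (λ b → distribʳ _ _ _) ⟨
    sum (λ b → coeff ((a , u) ∷ f) (e b) *ᴷ φ (e b)) ∎
    where
    term : φ u ≈ᴷ 0ᴷ ⊎ ∃[ b ] e b ≡ u → a *ᴷ φ u ≈ᴷ sum (λ b → entry a u (e b) *ᴷ φ (e b))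
    term (inj₁ φu≈0) = trans (trans (*-congˡ φu≈0) (zeroʳ a)) (sym (∑-zero {n} λ b → vanish b (u ≟ᵐ e b)))
      where
      vanish : ∀ b → Dec (u ≡ e b) → entry a u (e b) *ᴷ φ (e b) ≈ᴷ 0ᴷ
      vanish b (yes u≡) = trans (*-congˡ (≡.subst (λ w → φ w ≈ᴷ 0ᴷ) u≡ φu≈0)) (zeroʳ _)
      vanish b (no u≢)  = trans (*-congʳ (entry-≢ a u≢)) (zeroˡ _)
    term (inj₂ (b , ≡.refl)) = sym (trans
      (∑-single {n} (λ k → entry a u (e k) *ᴷ φ (e k)) b
        λ k k≢b → trans (*-congʳ (entry-≢ a (k≢b ∘ ≡.sym ∘ e-injective))) (zeroˡ _))
      (*-congʳ (entry-≡ a {u} ≡.refl)))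

  module Rank {p} (I : Ideal p) (isMonomial : IsMonomialIdeal I) where

    open Membership I
    open MonomialIdeal I isMonomial

    -- The product u g is in I because all of its terms are.
    injective⇒∈ : ∀ {i r} (g : Form r) → Injective _≈[ I ]_ _≈[ I ]_ (λ (f : Form i) → f *ᶠ g) →
                  ∀ u → deg u ≡ i → (∀ w → deg w ≡ r → pp (u · w) ∈ ⟦ I ⟧) → pp u ∈ ⟦ I ⟧
    injective⇒∈ (g , hg) inj u du u·w∈I =
      ≈[]0⇒∈ (inj {pp u , du ∷ []} {0ᶠ} (∈⇒≈[]0 (All-∈ (++⁺ (map⁺ (All.map (u·w∈I _) hg)) []))))

    -- A congruence f g = t modulo I with t free of x only involves the
    -- coefficients of f at the x-free power-products, listed by e.  So if there
    -- are more x-free power-products t outside I in the target degree, then they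
    -- cannot all be in the image of multiplication by g.
    ¬surjective : ∀ {i r n} (g : Form r)
      (e : Fin n → Monomial) → (∀ {j k} → e j ≡ e k → j ≡ k) →
      (∀ y z → deg (0 ∷ y ∷ z ∷ []) ≡ i → ∃[ b ] e b ≡ 0 ∷ y ∷ z ∷ []) →
      (t : Fin (suc n) → Monomial) → (∀ {j k} → t j ≡ t k → j ≡ k) →
      (∀ k → lookup (t k) zero ≡ 0) → (∀ k → deg (t k) ≡ i ℕ.+ r) → (∀ k → ¬ pp (t k) ∈ ⟦ I ⟧) →
      ¬ Surjective _≈[ I ]_ _≈[ I ]_ (λ (f : Form i) → f *ᶠ g)
    ¬surjective {i} {r} {n} g e e-injective e-complete t t-injective t-x-free t-deg t∉I surj =
      ¬-independent n A A-independent
      where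
      f : Fin (suc n) → Form i
      f k = proj₁ (surj (pp (t k) , t-deg k ∷ []))

      fg≈t : ∀ k → proj₁ (f k) * proj₁ g - pp (t k) ∈ ⟦ I ⟧
      fg≈t k = proj₂ (surj (pp (t k) , t-deg k ∷ [])) {f k} (≈[]-refl (proj₁ (f k)))

      A : Fin (suc n) → Fin n → Carrier
      A k b = coeff (proj₁ (f k)) (e b)

      φ : Fin (suc n) → Monomial → Carrier
      φ j u = coeff (u ▹ proj₁ g) (t j)

      classify : ∀ j u → deg u ≡ i → φ j u ≈ᴷ 0ᴷ ⊎ ∃[ b ] e b ≡ u
      classify j (zero ∷ y ∷ z ∷ [])  du = inj₂ (e-complete y z du)
      classify j (suc x ∷ y ∷ z ∷ []) du = inj₁ (coeff-▹-∤ u∤t (proj₁ g))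
        where
        u∤t : ∀ v → (suc x ∷ y ∷ z ∷ []) · v ≢ t j
        u∤t (_ ∷ _ ∷ _ ∷ []) eq with ≡.trans (≡.cong (λ w → lookup w zero) eq) (t-x-free j)
        ... | ()

      coeff-t : ∀ k j → sum (λ b → A k b *ᴷ φ j (e b)) ≈ᴷ coeff (pp (t k)) (t j)
      coeff-t k j = begin
        sum (λ b → A k b *ᴷ φ j (e b))     ≈⟨ eval-∑ (φ j) e e-injective (proj₁ (f k)) (All.map (classify j _) (proj₂ (f k))) ⟨
        eval (φ j) (proj₁ (f k))           ≈⟨ coeff-* (proj₁ (f k)) (proj₁ g) (t j) ⟨
        coeff (proj₁ (f k) * proj₁ g) (t j) ≈⟨ ≈[]⇒coeff≈ {proj₁ (f k) * proj₁ g} (fg≈t k) (t∉I j) ⟩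
        coeff (pp (t k)) (t j)             ∎

      A-independent : Independent A
      A-independent c cA≈0 j = begin
        c j                                                 ≈⟨ *-identityʳ _ ⟨
        c j *ᴷ 1ᴷ                                           ≈⟨ *-congˡ (coeff-pp-≡ {t j} ≡.refl) ⟨
        c j *ᴷ coeff (pp (t j)) (t j)                       ≈⟨ ∑-single (λ k → c k *ᴷ coeff (pp (t k)) (t j)) j
                                                                (λ k k≢j → trans (*-congˡ (coeff-pp-≢ (k≢j ∘ t-injective))) (zeroʳ _)) ⟨
        sum (λ k → c k *ᴷ coeff (pp (t k)) (t j))           ≈⟨ sum-cong-≋ {suc n} (λ k → *-congˡ {c k} (coeff-t k j)) ⟨
        sum (λ k → c k *ᴷ sum (λ b → A k b *ᴷ φ j (e b)))   ≈⟨ relation-* c A (φ j ∘ e) cA≈0 ⟩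
        0ᴷ                                                  ∎

  -- Comparison of dimensions

  -- If J contains I in degree d and both quotients have the same dimension
  -- there, then a power-product t of J cannot be outside I: a basis modulo J
  -- would remain independent modulo I after t is added.
  sameDimension⇒⊇ : ∀ {p q} (I : Ideal p) → IsMonomialIdeal I → (J : Ideal q) → IsMonomialIdeal J →
    (∀ i → ∃[ n ] HasDimension J i n) → ∀ {d n} → HasDimension I d n → HasDimension J d n →
    (∀ t → deg t ≡ d → pp t ∈ ⟦ I ⟧ → pp t ∈ ⟦ J ⟧) →
    ∀ t → deg t ≡ d → pp t ∈ ⟦ J ⟧ → ¬ ¬ pp t ∈ ⟦ I ⟧
  sameDimension⇒⊇ I I-mon J J-mon J-fin {d} {n} dimI dimJ I⊆J t dt t∈J t∉I =
    ¬-independent n A A-independent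
    where
    module I = HasDimension dimI
    module J = HasDimension dimJ
    open MonomialIdeal I I-mon using (≈[]⇒coeff≈)
    open MonomialIdeal J J-mon using (module FiniteDimensional)
    open FiniteDimensional J-fin using (coeff≈0⇒∈)
    open Membership J using (∈⇒≈[]0)

    v : Fin (suc n) → Form d
    v zero    = pp t , dt ∷ []
    v (suc k) = J.basis k

    A : Fin (suc n) → Fin n → Carrier
    A i = proj₁ (I.spanning (v i))

    A-independent : Independent A
    A-independent c cA≈0 = λ where
        zero    → c₀≈0
        (suc k) → tail≈0 k
      where
      coeff-v : ∀ m → ¬ pp m ∈ ⟦ I ⟧ → ∀ i →
                sum (λ j → A i j *ᴷ coeff (proj₁ (I.basis j)) m) ≈ᴷ coeff (proj₁ (v i)) m
      coeff-v m m∉I i = trans (sym (coeff-linearCombination (A i) I.basis m))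
        (≈[]⇒coeff≈ {proj₁ (linearCombination (A i) I.basis)} (proj₂ (I.spanning (v i))) m∉I)

      relation : ∀ m → ¬ pp m ∈ ⟦ I ⟧ → sum (λ i → c i *ᴷ coeff (proj₁ (v i)) m) ≈ᴷ 0ᴷ
      relation m m∉I = begin
        sum (λ i → c i *ᴷ coeff (proj₁ (v i)) m)
          ≈⟨ sum-cong-≋ {suc n} (λ i → *-congˡ {c i} (coeff-v m m∉I i)) ⟨
        sum (λ i → c i *ᴷ sum (λ j → A i j *ᴷ coeff (proj₁ (I.basis j)) m))
          ≈⟨ relation-* c A (λ j → coeff (proj₁ (I.basis j)) m) cA≈0 ⟩
        0ᴷ ∎

      tail : Form d
      tail = linearCombination (c ∘ suc) J.basis

      coeff-tail : ∀ m → ¬ pp m ∈ ⟦ J ⟧ → coeff (proj₁ tail) m ≈ᴷ 0ᴷ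
      coeff-tail m m∉J = ¬#0⇒≈0 λ c#0 → #0⇒≉0 c#0 (begin
        coeff (proj₁ tail) m
          ≈⟨ coeff-linearCombination (c ∘ suc) J.basis m ⟩
        sum (λ k → c (suc k) *ᴷ coeff (proj₁ (J.basis k)) m)
          ≈⟨ +-identityˡ _ ⟨
        0ᴷ +ᴷ sum (λ k → c (suc k) *ᴷ coeff (proj₁ (J.basis k)) m)
          ≈⟨ +-congʳ (trans (*-congˡ (coeff-pp-≢ {t} {m} λ where ≡.refl → m∉J t∈J)) (zeroʳ _)) ⟨
        c zero *ᴷ coeff (pp t) m +ᴷ sum (λ k → c (suc k) *ᴷ coeff (proj₁ (J.basis k)) m)
          ≈⟨ relation m (m∉J ∘ I⊆J m (coeff#0⇒deg tail m c#0)) ⟩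
        0ᴷ ∎)

      tail≈0 : ∀ k → c (suc k) ≈ᴷ 0ᴷ
      tail≈0 = J.independent (c ∘ suc) (∈⇒≈[]0 (coeff≈0⇒∈ (proj₁ tail) coeff-tail))

      c₀≈0 : c zero ≈ᴷ 0ᴷ
      c₀≈0 = begin
        c zero
          ≈⟨ *-identityʳ _ ⟨
        c zero *ᴷ 1ᴷ
          ≈⟨ *-congˡ (coeff-pp-≡ {t} ≡.refl) ⟨
        c zero *ᴷ coeff (pp t) t
          ≈⟨ +-identityʳ _ ⟨
        c zero *ᴷ coeff (pp t) t +ᴷ 0ᴷ
          ≈⟨ +-congˡ (∑-zero {n} λ k → trans (*-congʳ (tail≈0 k)) (zeroˡ _)) ⟨
        c zero *ᴷ coeff (pp t) t +ᴷ sum (λ k → c (suc k) *ᴷ coeff (proj₁ (J.basis k)) t)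
          ≈⟨ relation t t∉I ⟩
        0ᴷ ∎

-- Strongly stable ideals

open import Data.Nat.Properties using (+-suc; +-comm; +-assoc; +-identityʳ; +-cancelʳ-≡;
  m+n∸m≡n; m≤m+n; m+[n∸m]≡n; m∸n+n≡m;
  <-irrefl; <⇒≤; <-cmp; <-≤-trans; ≤-refl; ≤-reflexive; suc-injective)

var-·-deg : ∀ i u → deg (var i · u) ≡ suc (deg u)
var-·-deg zero             (a ∷ b ∷ c ∷ []) = ≡.refl
var-·-deg (suc zero)       (a ∷ b ∷ c ∷ []) = +-suc a _
var-·-deg (suc (suc zero)) (a ∷ b ∷ c ∷ []) = ≡.trans (≡.cong (a ℕ.+_) (+-suc b _)) (+-suc a _)

module StronglyStableIdeals {c ℓ₁ ℓ₂ : Level} (K : HeytingField c ℓ₁ ℓ₂) where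

  open Polynomials K
  open Coefficients K

  module _ {p} (I : Ideal p) (stable : StronglyStable I) (slp : SLP I) where

    open StronglyStable stable
    open SLP slp
    open Membership I using (·-∈)
    open MonomialIdeal I isMonomial using (module FiniteDimensional)
    open FiniteDimensional finiteDimensional using (∈?_; generates)
    open Rank I isMonomial

    private
      -- x^a y^b z^c lies in I.
      M : ℕ → ℕ → ℕ → Set _
      M a b c = pp (a ∷ b ∷ c ∷ []) ∈ ⟦ I ⟧

    -- Replace k factors y by x, or k factors z by y.
    y→x : ∀ k {a b c} → M a (k ℕ.+ b) c → M (k ℕ.+ a) b c
    y→x zero    m = m
    y→x (suc k) {a} {b} {c} m = ≡.subst (λ a → M a b c) (+-suc k a)
      (y→x k (exchange _ (a ∷ k ℕ.+ b ∷ c ∷ []) {zero} {suc zero} (s≤s z≤n) ≡.refl m))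

    z→y : ∀ k {a b c} → M a b (k ℕ.+ c) → M a (k ℕ.+ b) c
    z→y zero    m = m
    z→y (suc k) {a} {b} {c} m = ≡.subst (λ b → M a b c) (+-suc k b)
      (z→y k (exchange _ (a ∷ b ∷ k ℕ.+ c ∷ []) {suc zero} {suc (suc zero)} (s≤s (s≤s z≤n)) ≡.refl m))

    -- If x^a y^b z^c is in I, then so is x^a y^b w for each w of degree c.
    z-power⇒∈ : ∀ a b c → M a b c → ∀ w → deg w ≡ c → pp ((a ∷ b ∷ 0 ∷ []) · w) ∈ ⟦ I ⟧
    z-power⇒∈ a b c m (k ∷ l ∷ n ∷ []) ≡.refl =
      ≡.subst (λ t → pp t ∈ ⟦ I ⟧)
        (≡.cong₂ _∷_ (+-comm k a) (≡.cong₂ _∷_ (+-comm l b) (≡.cong (_∷ []) (+-identityʳ n))))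
        (z→y l (y→x k (z→y k m)))

    -- If x^a y^b z^(c+1) is in I but x^a y^b z^c is not, then multiplication by
    -- the (c+1)-st power of the Lefschetz element is not injective in degree
    -- a + b, so it is surjective.  Then y^(a+b+1) z^c is in I: otherwise all
    -- y^k z^(a+b+1-k+c) with k at most a + b + 1 would be outside I by strong
    -- stability, which is too many for the x-free power-products e of degree a + b.
    lefschetz : ∀ a b c → M a b (suc c) → ¬ M a b c → M 0 (suc (a ℕ.+ b)) c
    lefschetz a b c m ¬m with fullRank (a ℕ.+ b) (suc c) (s≤s z≤n)
    ... | inj₁ inj = contradiction
      (≡.subst (M a b) (+-identityʳ c) (·-∈ (0 ∷ 0 ∷ c ∷ [])
        (injective⇒∈ (element ^ᶠ suc c) (λ {f} {g} → inj {f} {g}) (a ∷ b ∷ 0 ∷ []) (≡.cong (a ℕ.+_) (+-identityʳ b))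
          (z-power⇒∈ a b (suc c) m))))
      ¬m
    ... | inj₂ surj with ∈? (0 ∷ suc (a ℕ.+ b) ∷ c ∷ [])
    ...   | yes m′ = m′
    ...   | no ¬m′ = contradiction surj
      (¬surjective (element ^ᶠ suc c) e e-injective e-complete t t-injective (λ _ → ≡.refl) t-deg t∉I)
      where
      i : ℕ
      i = a ℕ.+ b

      e : Fin (suc i) → Monomial
      e k = 0 ∷ toℕ k ∷ i ∸ toℕ k ∷ []

      e-injective : ∀ {j k} → e j ≡ e k → j ≡ k
      e-injective eq = Fin.toℕ-injective (≡.cong (λ v → lookup v (suc zero)) eq)

      e-complete : ∀ y z → deg (0 ∷ y ∷ z ∷ []) ≡ i → ∃[ k ] e k ≡ 0 ∷ y ∷ z ∷ []
      e-complete y z d = fromℕ< (s≤s y≤i) , ≡.cong (0 ∷_) (≡.trans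
          (≡.cong (λ k → k ∷ i ∸ k ∷ []) (Fin.toℕ-fromℕ< (s≤s y≤i)))
          (≡.cong (λ k → y ∷ k ∷ []) (≡.trans (≡.cong (_∸ y) (≡.sym y+z≡i)) (m+n∸m≡n y z))))
        where
        y+z≡i : y ℕ.+ z ≡ i
        y+z≡i = ≡.trans (≡.cong (y ℕ.+_) (≡.sym (+-identityʳ z))) d
        y≤i : y ℕ.≤ i
        y≤i = ≡.subst (y ℕ.≤_) y+z≡i (m≤m+n y z)

      t : Fin (suc (suc i)) → Monomial
      t k = 0 ∷ toℕ k ∷ suc i ∸ toℕ k ℕ.+ c ∷ []

      t-injective : ∀ {j k} → t j ≡ t k → j ≡ k
      t-injective eq = Fin.toℕ-injective (≡.cong (λ v → lookup v (suc zero)) eq)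

      t-deg : ∀ k → deg (t k) ≡ i ℕ.+ suc c
      t-deg k = begin
        toℕ k ℕ.+ (suc i ∸ toℕ k ℕ.+ c ℕ.+ 0) ≡⟨ ≡.cong (toℕ k ℕ.+_) (+-identityʳ _) ⟩
        toℕ k ℕ.+ (suc i ∸ toℕ k ℕ.+ c)       ≡⟨ +-assoc (toℕ k) _ c ⟨
        toℕ k ℕ.+ (suc i ∸ toℕ k) ℕ.+ c       ≡⟨ ≡.cong (ℕ._+ c) (m+[n∸m]≡n (Fin.toℕ≤pred[n] k)) ⟩
        suc i ℕ.+ c                           ≡⟨ +-suc i c ⟨
        i ℕ.+ suc c                           ∎
        where open ≡.≡-Reasoning

      t∉I : ∀ k → ¬ pp (t k) ∈ ⟦ I ⟧
      t∉I k m = ¬m′ (≡.subst (λ b → M 0 b c) (m∸n+n≡m (Fin.toℕ≤pred[n] k)) (z→y (suc i ∸ toℕ k) m))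

    -- The minimal generators: power-products of I whose quotient by any
    -- variable is outside I.
    MinimalGenerator : Pred Monomial p
    MinimalGenerator t = pp t ∈ ⟦ I ⟧ × (∀ i u → t ≡ var i · u → ¬ pp u ∈ ⟦ I ⟧)

    minimalGenerator-revlex : ∀ t t′ → MinimalGenerator t → deg t′ ≡ deg t → t′ >DegRevLex t → pp t′ ∈ ⟦ I ⟧
    minimalGenerator-revlex t t′ _ eq (inj₁ lt) = contradiction lt (<-irrefl (≡.sym eq))
    -- The exponent of x cannot be the only one that differs, as the degrees agree.
    minimalGenerator-revlex (a ∷ b ∷ c ∷ []) (a′ ∷ b′ ∷ c′ ∷ []) _ eq (inj₂ (_ , zero , lt , agree))
      with agree (suc zero) (s≤s z≤n) | agree (suc (suc zero)) (s≤s z≤n)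
    ... | ≡.refl | ≡.refl = contradiction lt (<-irrefl (+-cancelʳ-≡ _ a′ a eq))
    minimalGenerator-revlex (a ∷ b ∷ c ∷ []) (a′ ∷ b′ ∷ c′ ∷ []) (t∈I , _) eq (inj₂ (_ , suc zero , lt , agree))
      with agree (suc (suc zero)) (s≤s (s≤s z≤n))
    ... | ≡.refl with b ∸ b′ | m∸n+n≡m (<⇒≤ lt)
    ...   | d | ≡.refl = ≡.subst (λ a → M a b′ c) (≡.sym (rearrange eq)) (y→x d t∈I)
      where
      rearrange : a′ ℕ.+ (b′ ℕ.+ (c ℕ.+ 0)) ≡ a ℕ.+ (d ℕ.+ b′ ℕ.+ (c ℕ.+ 0)) → a′ ≡ d ℕ.+ a
      rearrange eq = +-cancelʳ-≡ (b′ ℕ.+ (c ℕ.+ 0)) a′ (d ℕ.+ a) (≡.trans eq (solve (a List.∷ b′ List.∷ c List.∷ d List.∷ List.[])))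
    -- Here t / z is outside I by minimality.
    minimalGenerator-revlex (a ∷ b ∷ suc c ∷ []) (a′ ∷ b′ ∷ c′ ∷ []) (t∈I , minimal) eq (inj₂ (_ , suc (suc zero) , s≤s c′≤c , _))
      with c ∸ c′ | m∸n+n≡m c′≤c
    ... | d | ≡.refl = ≡.subst (λ a → M a b′ c′) (+-identityʳ a′)
      (y→x a′ (≡.subst (λ b → M 0 b c′) (≡.sym (rearrange eq)) (z→y d
        (lefschetz a b (d ℕ.+ c′) t∈I (minimal (suc (suc zero)) (a ∷ b ∷ d ℕ.+ c′ ∷ []) ≡.refl)))))
      where
      rearrange : a′ ℕ.+ (b′ ℕ.+ (c′ ℕ.+ 0)) ≡ a ℕ.+ (b ℕ.+ (suc (d ℕ.+ c′) ℕ.+ 0)) →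
                  a′ ℕ.+ b′ ≡ d ℕ.+ suc (a ℕ.+ b)
      rearrange eq = +-cancelʳ-≡ c′ (a′ ℕ.+ b′) (d ℕ.+ suc (a ℕ.+ b)) (begin
        a′ ℕ.+ b′ ℕ.+ c′                        ≡⟨ solve (a′ List.∷ b′ List.∷ c′ List.∷ List.[]) ⟩
        a′ ℕ.+ (b′ ℕ.+ (c′ ℕ.+ 0))              ≡⟨ eq ⟩
        a ℕ.+ (b ℕ.+ (suc (d ℕ.+ c′) ℕ.+ 0))    ≡⟨ solve (a List.∷ b List.∷ c′ List.∷ d List.∷ List.[]) ⟩
        d ℕ.+ suc (a ℕ.+ b) ℕ.+ c′              ∎)
        where open ≡.≡-Reasoning

    -- Is t divisible by the i-th variable with quotient in I?
    quotient∈? : ∀ i t → Dec (∃[ u ] (t ≡ var i · u × pp u ∈ ⟦ I ⟧))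
    quotient∈? zero             (zero ∷ b ∷ c ∷ [])  = no λ where ((_ ∷ _ ∷ _ ∷ []) , () , _)
    quotient∈? zero             (suc a ∷ b ∷ c ∷ []) =
      map′ (λ m → _ , ≡.refl , m) (λ where ((_ ∷ _ ∷ _ ∷ []) , ≡.refl , m) → m) (∈? (a ∷ b ∷ c ∷ []))
    quotient∈? (suc zero)       (a ∷ zero ∷ c ∷ [])  = no λ where ((_ ∷ _ ∷ _ ∷ []) , () , _)
    quotient∈? (suc zero)       (a ∷ suc b ∷ c ∷ []) =
      map′ (λ m → _ , ≡.refl , m) (λ where ((_ ∷ _ ∷ _ ∷ []) , ≡.refl , m) → m) (∈? (a ∷ b ∷ c ∷ []))
    quotient∈? (suc (suc zero)) (a ∷ b ∷ zero ∷ [])  = no λ where ((_ ∷ _ ∷ _ ∷ []) , () , _)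
    quotient∈? (suc (suc zero)) (a ∷ b ∷ suc c ∷ []) =
      map′ (λ m → _ , ≡.refl , m) (λ where ((_ ∷ _ ∷ _ ∷ []) , ≡.refl , m) → m) (∈? (a ∷ b ∷ c ∷ []))

    -- Divide by variables for as long as the quotient stays in I; n bounds the
    -- number of steps.
    minimalDivisor : ∀ n t → deg t ≡ n → pp t ∈ ⟦ I ⟧ → ∃[ g ] ∃[ w ] (MinimalGenerator g × t ≡ w · g)
    minimalDivisor n t dt t∈I with Fin.any? (λ i → quotient∈? i t)
    ... | no ¬q = t , 𝟙 , (t∈I , λ i u t≡ u∈I → ¬q (i , u , t≡ , u∈I)) , ≡.sym (·-identityˡ t)
    minimalDivisor zero .(var i · u) dt t∈I | yes (i , u , ≡.refl , u∈I) with ≡.trans (≡.sym dt) (var-·-deg i u)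
    ... | ()
    minimalDivisor (suc n) .(var i · u) dt t∈I | yes (i , u , ≡.refl , u∈I)
      with minimalDivisor n u (suc-injective (≡.trans (≡.sym (var-·-deg i u)) dt)) u∈I
    ... | g , w , Gg , ≡.refl = g , var i · w , Gg , ≡.sym (zipWith-assoc +-assoc (var i) w g)

    minimalGenerators : IsMinimalGeneratingSet MinimalGenerator I
    minimalGenerators = record
      { generates = generates proj₁ (λ t → minimalDivisor (deg t) t ≡.refl)
      ; minimal   = minimal
      }
      where
      minimal : (G : Pred Monomial p) → G ⊆ MinimalGenerator → Generates G I → MinimalGenerator ⊆ G
      minimal G G⊆ G-generates {t} (t∈I , min)
        with ⟨⟩-divisor {f = pp t} (proj₁ G-generates t∈I) t (coeff-pp#0 t)
      ... | (x ∷ y ∷ z ∷ []) , (zero ∷ zero ∷ zero ∷ []) , Gg , ≡.refl = Gg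
      ... | (x ∷ y ∷ z ∷ []) , (zero ∷ zero ∷ suc c ∷ []) , Gg , ≡.refl =
        contradiction (·-∈ (0 ∷ 0 ∷ c ∷ []) (proj₁ (G⊆ Gg))) (min (suc (suc zero)) _ ≡.refl)
      ... | (x ∷ y ∷ z ∷ []) , (zero ∷ suc b ∷ c ∷ []) , Gg , ≡.refl =
        contradiction (·-∈ (0 ∷ b ∷ c ∷ []) (proj₁ (G⊆ Gg))) (min (suc zero) _ ≡.refl)
      ... | (x ∷ y ∷ z ∷ []) , (suc a ∷ b ∷ c ∷ []) , Gg , ≡.refl =
        contradiction (·-∈ (a ∷ b ∷ c ∷ []) (proj₁ (G⊆ Gg))) (min zero _ ≡.refl)

    almostRevlex : AlmostRevlex I
    almostRevlex = MinimalGenerator , minimalGenerators , minimalGenerator-revlex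

  -- Uniqueness

  >DegRevLex-total : ∀ t t′ → deg t ≡ deg t′ → t ≡ t′ ⊎ t >DegRevLex t′ ⊎ t′ >DegRevLex t
  >DegRevLex-total (a ∷ b ∷ c ∷ []) (a′ ∷ b′ ∷ c′ ∷ []) eq with <-cmp c c′
  ... | tri< c<c′ _ _ = inj₂ (inj₁ (inj₂ (eq , suc (suc zero) , c<c′ , λ where (suc (suc zero)) (s≤s (s≤s ())))))
  ... | tri> _ _ c>c′ = inj₂ (inj₂ (inj₂ (≡.sym eq , suc (suc zero) , c>c′ , λ where (suc (suc zero)) (s≤s (s≤s ())))))
  ... | tri≈ _ ≡.refl _ with <-cmp b b′
  ...   | tri< b<b′ _ _ = inj₂ (inj₁ (inj₂ (eq , suc zero , b<b′ , λ where
    (suc zero) (s≤s ())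
    (suc (suc zero)) _ → ≡.refl)))
  ...   | tri> _ _ b>b′ = inj₂ (inj₂ (inj₂ (≡.sym eq , suc zero , b>b′ , λ where
    (suc zero) (s≤s ())
    (suc (suc zero)) _ → ≡.refl)))
  ...   | tri≈ _ ≡.refl _ = inj₁ (≡.cong (_∷ b ∷ c ∷ []) (+-cancelʳ-≡ _ a a′ eq))

  -- A power-product of I outside J is a minimal generator of I if I is contained
  -- in J in smaller degrees.
  ∉⇒minimal : ∀ {p q} (I : Ideal p) (I-stable : StronglyStable I) (I-slp : SLP I) (J : Ideal q) t →
    (∀ u → deg u ℕ.< deg t → pp u ∈ ⟦ I ⟧ → pp u ∈ ⟦ J ⟧) →
    pp t ∈ ⟦ I ⟧ → ¬ pp t ∈ ⟦ J ⟧ → MinimalGenerator I I-stable I-slp t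
  ∉⇒minimal I _ _ J t I⊆J t∈I t∉J = t∈I , λ where
      i u ≡.refl u∈I → t∉J (·-∈ (var i) (I⊆J u (≤-reflexive (≡.sym (var-·-deg i u))) u∈I))
    where open Membership J using (·-∈)

  module _ {p q} (I : Ideal p) (I-stable : StronglyStable I) (I-slp : SLP I)
           (J : Ideal q) (J-stable : StronglyStable J) (J-slp : SLP J) where

    private
      module I-stable = StronglyStable I-stable
      module J-stable = StronglyStable J-stable
      module I-slp = SLP I-slp
      module J-slp = SLP J-slp
      module I-finite = MonomialIdeal.FiniteDimensional I I-stable.isMonomial I-slp.finiteDimensional
      module J-finite = MonomialIdeal.FiniteDimensional J J-stable.isMonomial J-slp.finiteDimensional

    -- If I and J agree in degrees less than d, then in degree d one of them
    -- contains the other: t in I but not J and t′ in J but not I would be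
    -- minimal generators, and the larger of the two would be in both ideals.
    comparable : ∀ t t′ → deg t ≡ deg t′ →
      (∀ u → deg u ℕ.< deg t → (pp u ∈ ⟦ I ⟧ → pp u ∈ ⟦ J ⟧) × (pp u ∈ ⟦ J ⟧ → pp u ∈ ⟦ I ⟧)) →
      pp t ∈ ⟦ I ⟧ → ¬ pp t ∈ ⟦ J ⟧ → pp t′ ∈ ⟦ J ⟧ → ¬ ¬ pp t′ ∈ ⟦ I ⟧
    comparable t t′ eq agree t∈I t∉J t′∈J t′∉I with >DegRevLex-total t t′ eq
    ... | inj₁ ≡.refl = t′∉I t∈I
    ... | inj₂ (inj₁ t>t′) = t∉J (minimalGenerator-revlex J J-stable J-slp t′ t
      (∉⇒minimal J J-stable J-slp I t′ (λ u u< → proj₂ (agree u (≡.subst (deg u ℕ.<_) (≡.sym eq) u<))) t′∈J t′∉I) eq t>t′)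
    ... | inj₂ (inj₂ t′>t) = t′∉I (minimalGenerator-revlex I I-stable I-slp t t′
      (∉⇒minimal I I-stable I-slp J t (λ u u< → proj₁ (agree u u<)) t∈I t∉J) (≡.sym eq) t′>t)

    module _ {H : ℕ → ℕ} (I-dim : IsHilbertFunction I H) (J-dim : IsHilbertFunction J H) where

      agree-below : ∀ n t → deg t ℕ.< n →
                    (pp t ∈ ⟦ I ⟧ → pp t ∈ ⟦ J ⟧) × (pp t ∈ ⟦ J ⟧ → pp t ∈ ⟦ I ⟧)
      agree-below (suc n) t (s≤s t≤n) = I⊆J , J⊆I
        where
        agree : ∀ u → deg u ℕ.< deg t → (pp u ∈ ⟦ I ⟧ → pp u ∈ ⟦ J ⟧) × (pp u ∈ ⟦ J ⟧ → pp u ∈ ⟦ I ⟧)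
        agree u u<t = agree-below n u (<-≤-trans u<t t≤n)

        I⊆J : pp t ∈ ⟦ I ⟧ → pp t ∈ ⟦ J ⟧
        I⊆J t∈I = decidable-stable (J-finite.∈? t) λ t∉J →
          sameDimension⇒⊇ J J-stable.isMonomial I I-stable.isMonomial I-slp.finiteDimensional
            (J-dim (deg t)) (I-dim (deg t))
            (λ t′ eq t′∈J → decidable-stable (I-finite.∈? t′)
              (comparable t t′ (≡.sym eq) agree t∈I t∉J t′∈J))
            t ≡.refl t∈I t∉J

        J⊆I : pp t ∈ ⟦ J ⟧ → pp t ∈ ⟦ I ⟧
        J⊆I t∈J = decidable-stable (I-finite.∈? t) λ t∉I →
          sameDimension⇒⊇ I I-stable.isMonomial J J-stable.isMonomial J-slp.finiteDimensional
            (I-dim (deg t)) (J-dim (deg t))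
            (λ t′ eq t′∈I → decidable-stable (J-finite.∈? t′) λ t′∉J →
              comparable t′ t eq (λ u u< → agree u (≡.subst (deg u ℕ.<_) eq u<)) t′∈I t′∉J t∈J t∉I)
            t ≡.refl t∈J t∉I

      agree-everywhere : ∀ t → (pp t ∈ ⟦ I ⟧ → pp t ∈ ⟦ J ⟧) × (pp t ∈ ⟦ J ⟧ → pp t ∈ ⟦ I ⟧)
      agree-everywhere t = agree-below (suc (deg t)) t ≤-refl

      hilbertFunction-unique : ⟦ J ⟧ ≐ ⟦ I ⟧
      hilbertFunction-unique =
          (λ {f} f∈J → I-finite.coeff≈0⇒∈ f λ m m∉I →
            J-monomial.∉⇒coeff≈0 f∈J (m∉I ∘ proj₂ (agree-everywhere m)))
        , (λ {f} f∈I → J-finite.coeff≈0⇒∈ f λ m m∉J →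
            I-monomial.∉⇒coeff≈0 f∈I (m∉J ∘ proj₁ (agree-everywhere m)))
        where
        module I-monomial = MonomialIdeal I I-stable.isMonomial
        module J-monomial = MonomialIdeal J J-stable.isMonomial

theorem5p8 : ∀ {c ℓ₁ ℓ₂ p q} (K : HeytingField c ℓ₁ ℓ₂) →
    let open Polynomials K in
    CharacteristicZero →
    (I : Ideal p) → StronglyStable I → SLP I →
    AlmostRevlex I ×
    ((I′ : Ideal q) → StronglyStable I′ → SLP I′ →
      SameHilbertFunction I I′ → ⟦ I′ ⟧ ≐ ⟦ I ⟧)
theorem5p8 K _ I stable slp =
    almostRevlex I stable slp
  , λ I′ stable′ slp′ (H , I-dim , I′-dim) →
      hilbertFunction-unique I stable slp I′ stable′ slp′ I-dim I′-dim
  where open StronglyStableIdeals K
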